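{- Let $T_4^{(2)}(x,y):=\sum_{n\ge 1}x^n\sum_{T\in\mathcal{T}^{(2)}(K_4\times P_n)}y^{\rho(T)}$. Then $$T_4^{(2)}(x,y)=\frac{2xy\left(1+7y-x(y-1)\left(7y^2+y-9\right)+x^2(y-1)^2\left(8y^2-17y+8\right)\right)}{1-2x(y^2+2y+5)+x^2(y-1)(y^3+6y^2+8y-17)-x^3(y-1)^2(y^3+6y^2-17y+8)}.$$
   Context: $K_m$ is the complete graph on $m$ vertices and $P_n$ the path graph on $n$ vertices. The product $G_1\times G_2$ of graphs $G_1=(V_1,E_1)$, $G_2=(V_2,E_2)$ is the Cartesian product: its vertex set is $V_1\times V_2$, and $(v_1,v_2),(w_1,w_2)$ are adjacent iff ($v_1=w_1$ and $\{v_2,w_2\}\in E_2$) or ($v_2=w_2$ and $\{v_1,w_1\}\in E_1$). For a finite undirected graph $G=(V,E)$, two nonempty disjoint subsets $V_1,V_2\subseteq V$ are neighbors if there is an edge of $G$ with one endpoint in $V_1$ and the other in $V_2$. A $k$-colored partition of $G$ is a partition $V=\bigcup_{i=1}^s V_i$ together with an assignment of one of $k$ colors to each $V_i$ (all vertices of $V_i$ get that color), such that each $V_i$ induces a connected subgraph of $G$ and any two neighboring sets $V_i,V_j$ have different colors. The sets $V_i$ are the blocks, and the size $\rho(T)$ of a $k$-colored partition $T$ is its number of blocks. $\mathcal{T}^{(k)}(G)$ denotes the set of all $k$-colored partitions of $G$. Generating functions are formal power series in $x$ with coefficients polynomial in $y$. -}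

module Defs where

open import Data.Fin.Base using (Fin; toℕ)
open import Data.Fin.Properties using (*↔×)
open import Data.Integer.Base as ℤ using (ℤ; 0ℤ; 1ℤ)
open import Data.List.Base using (List; []; _∷_; map; foldr; applyUpTo)
import Data.List.Relation.Unary.Enumerates.Setoid as Enumerates
import Data.List.Relation.Unary.Unique.Setoid as UniqueList
open import Data.Nat.Base as ℕ using (ℕ; zero; suc; _∸_)
open import Data.Product.Base using (∃₂; _×_; _,_)
open import Data.Product.Function.NonDependent.Propositional using (_×-↔_)
open import Data.Sum.Base using (_⊎_; inj₁; inj₂; swap)
import Data.Sum.Base as Sum
import Data.Product.Base as Product
open import Function.Bundles using (_↔_; _⇔_)
open import Function.Construct.Composition using (_↔-∘_; _⇔-∘_)
open import Function.Construct.Identity using (↔-id; ⇔-id)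
open import Function.Construct.Symmetry using (↔-sym; ⇔-sym)
open import Level using (0ℓ)
open import Relation.Binary.Bundles using (Setoid)
open import Relation.Binary.Construct.Closure.ReflexiveTransitive using (Star)
open import Relation.Binary.Definitions using (Symmetric; Irreflexive)
open import Relation.Binary.PropositionalEquality using (_≡_; _≢_; refl; sym; trans)
open import Relation.Unary using (Pred; Satisfiable)

record Graph : Set₁ where
  field
    Vertex  : Set
    order   : ℕ
    finite  : Vertex ↔ Fin order
    Adj     : Vertex → Vertex → Set
    adj-sym : Symmetric Adj
    no-loop : Irreflexive _≡_ Adj

K : ℕ → Graph
K m = record
  { Vertex  = Fin m
  ; order   = m
  ; finite  = ↔-id (Fin m)
  ; Adj     = _≢_
  ; adj-sym = λ i≢j j≡i → i≢j (sym j≡i)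
  ; no-loop = λ i≡j i≢j → i≢j i≡j
  }

P : ℕ → Graph
P n = record
  { Vertex  = Fin n
  ; order   = n
  ; finite  = ↔-id (Fin n)
  ; Adj     = λ i j → toℕ j ≡ suc (toℕ i) ⊎ toℕ i ≡ suc (toℕ j)
  ; adj-sym = swap
  ; no-loop = λ { refl (inj₁ e) → n≢1+n e ; refl (inj₂ e) → n≢1+n e }
  }
  where
  n≢1+n : ∀ {a} → a ≢ suc a
  n≢1+n ()

infixl 7 _□_

_□_ : Graph → Graph → Graph
G □ H = record
  { Vertex  = G.Vertex × H.Vertex
  ; order   = G.order ℕ.* H.order
  ; finite  = ↔-sym *↔× ↔-∘ (G.finite ×-↔ H.finite)
  ; Adj     = λ (v₁ , v₂) (w₁ , w₂) →
                (v₁ ≡ w₁ × H.Adj v₂ w₂) ⊎ (v₂ ≡ w₂ × G.Adj v₁ w₁)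
  ; adj-sym = Sum.map (Product.map sym H.adj-sym) (Product.map sym G.adj-sym)
  ; no-loop = λ { refl (inj₁ (_ , a)) → H.no-loop refl a
                ; refl (inj₂ (_ , a)) → G.no-loop refl a }
  }
  where
  module G = Graph G
  module H = Graph H

module _ (G : Graph) where
  open Graph G

  -- Any two vertices of S are joined by a walk of G that stays in S.
  ConnectedIn : Pred Vertex 0ℓ → Set
  ConnectedIn S =
    ∀ {u v} → S u → S v → Star (λ a b → S a × S b × Adj a b) u v

  Neighbours : Pred Vertex 0ℓ → Pred Vertex 0ℓ → Set
  Neighbours S S′ = ∃₂ λ u v → S u × S′ v × Adj u v

-- The blocks V₁, …, V_s are given by the map sending each vertex to the index
-- of the block containing it, so they are disjoint and cover the vertex set.
-- The numbering of the blocks is not part of the partition: it is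
-- disregarded by _≋_ below.
record ColoredPartition (k : ℕ) (G : Graph) : Set where
  open Graph G
  field
    size   : ℕ
    index  : Vertex → Fin size
    colour : Fin size → Fin k

  Block : Fin size → Pred Vertex 0ℓ
  Block i v = index v ≡ i

  field
    nonempty  : ∀ i → Satisfiable (Block i)
    connected : ∀ i → ConnectedIn G (Block i)
    proper    : ∀ {i j} → i ≢ j → Neighbours G (Block i) (Block j) →
                colour i ≢ colour j

open ColoredPartition public using (size)

module _ {k : ℕ} {G : Graph} where
  open Graph G
  open ColoredPartition

  infix 4 _≋_

  -- Equality of colored partitions: the same blocks with the same colors.
  _≋_ : ColoredPartition k G → ColoredPartition k G → Set
  T ≋ T′ =
    (∀ u v → (index T u ≡ index T v) ⇔ (index T′ u ≡ index T′ v)) ×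
    (∀ v → colour T (index T v) ≡ colour T′ (index T′ v))

𝒯 : ℕ → Graph → Setoid 0ℓ 0ℓ
𝒯 k G = record
  { Carrier       = ColoredPartition k G
  ; _≈_           = _≋_
  ; isEquivalence = record
    { refl  = (λ _ _ → ⇔-id _) , (λ _ → refl)
    ; sym   = λ (p , q) → (λ u v → ⇔-sym (p u v)) , (λ v → sym (q v))
    ; trans = λ (p , q) (p′ , q′) →
        (λ u v → p′ u v ⇔-∘ p u v) , (λ v → trans (q v) (q′ v))
    }
  }

-- A list in which every element of S occurs exactly once (up to the equality
-- of S); sums over the finite set S are sums over such a list.
record Listing (S : Setoid 0ℓ 0ℓ) : Set where
  field
    elements : List (Setoid.Carrier S)
    complete : Enumerates.IsEnumeration S elements
    unique   : UniqueList.Unique S elements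

-- ℤ[y]: coefficient lists, constant term first, trailing zeros allowed

Poly : Set
Poly = List ℤ

coeff : Poly → ℕ → ℤ
coeff []      _       = 0ℤ
coeff (a ∷ p) zero    = a
coeff (a ∷ p) (suc r) = coeff p r

infix 4 _≈ₚ_
infixl 6 _+ₚ_
infixl 7 _*ₚ_
infixr 8 _^ₚ_

_≈ₚ_ : Poly → Poly → Set
p ≈ₚ q = ∀ r → coeff p r ≡ coeff q r

0ₚ 1ₚ yₚ : Poly
0ₚ = []
1ₚ = 1ℤ ∷ []
yₚ = 0ℤ ∷ 1ℤ ∷ []

_+ₚ_ : Poly → Poly → Poly
[]      +ₚ q       = q
(a ∷ p) +ₚ []      = a ∷ p
(a ∷ p) +ₚ (b ∷ q) = (a ℤ.+ b) ∷ (p +ₚ q)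

-ₚ_ : Poly → Poly
-ₚ p = map (λ a → ℤ.- a) p

_*ₚ_ : Poly → Poly → Poly
[]      *ₚ q = []
(a ∷ p) *ₚ q = map (a ℤ.*_) q +ₚ (0ℤ ∷ (p *ₚ q))

_^ₚ_ : Poly → ℕ → Poly
p ^ₚ zero  = 1ₚ
p ^ₚ suc r = p *ₚ (p ^ₚ r)

sumₚ : List Poly → Poly
sumₚ = foldr _+ₚ_ 0ₚ

-- ℤ[y][[x]]: the n-th value is the coefficient of xⁿ

Series : Set
Series = ℕ → Poly

infix 4 _≈_
infixl 6 _+_ _-_
infixl 7 _*_
infixr 8 _^_
infix 9 #_

_≈_ : Series → Series → Set
f ≈ g = ∀ n → f n ≈ₚ g n

constant : Poly → Series
constant p zero    = p
constant p (suc n) = 0ₚ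

#_ : ℕ → Series
# m = constant (ℤ.+ m ∷ [])

x y : Series
x zero          = 0ₚ
x (suc zero)    = 1ₚ
x (suc (suc n)) = 0ₚ
y = constant yₚ

_+_ _-_ _*_ : Series → Series → Series
(f + g) n = f n +ₚ g n
(f - g) n = f n +ₚ (-ₚ g n)
(f * g) n = sumₚ (applyUpTo (λ i → f i *ₚ g (n ∸ i)) (suc n))

_^_ : Series → ℕ → Series
f ^ zero  = # 1
f ^ suc r = f * (f ^ r)

-- f = N / D. The denominator is required to have constant term 1 in x, hence
-- to be invertible in ℤ[y][[x]], so that f is determined by N and D.
record _≈_/_ (f N D : Series) : Set where
  field
    leading  : D 0 ≈ₚ 1ₚ
    quotient : f * D ≈ N

infix 4 _≈_/_


-- Σ_{T ∈ 𝒯⁽ᵏ⁾(G)} y^ρ(T)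
blockPoly : ∀ {k G} → Listing (𝒯 k G) → Poly
blockPoly L = sumₚ (map (λ T → yₚ ^ₚ size T) (Listing.elements L))

-- Σ_{n ≥ 1} xⁿ Σ_{T ∈ 𝒯⁽ᵏ⁾(K_m × P_n)} y^ρ(T)
genFun : ∀ {m k} → (∀ n → Listing (𝒯 k (K m □ P n))) → Series
genFun L zero    = 0ₚ
genFun L (suc n) = blockPoly (L (suc n))

{-# OPTIONS --safe #-}

-- In a colored partition adjacent vertices of the same color lie in the same
-- block, so the blocks are the monochromatic components and the partition is
-- determined by the colors of the vertices. Every column of K m □ P n is a
-- clique, hence each color present in a column belongs to one component there,
-- and putting a column in front of a coloring never merges components: it adds
-- one for each of its colors that does not recur in the same row of the next
-- column. The block polynomials are therefore given by powers of a transfer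
-- matrix M indexed by the k ^ m columns. For k = 2 and m = 4, let e be the row
-- vector (1, …, 1) and Dᵢ the coefficient of xⁱ in the denominator. Then
--   D₀ eM³ + D₁ eM² + D₂ eM + D₃ e = 0,
-- so generating function times denominator has no terms from x⁴ on.
module Submission where

open import Defs
open import Algebra.Bundles using (CommutativeMonoid)
import Algebra.Properties.CommutativeSemigroup as CommutativeSemigroup
open import Algebra.Structures using (IsCommutativeMonoid)
open import Data.Bool.Base using (Bool; true; _∧_; T)
open import Data.Bool.Properties using (T-∧; T?)
open import Data.Empty using (⊥)
open import Data.Fin.Base using (Fin; zero; suc; toℕ)
import Data.Fin.Properties as Fin
open import Data.Integer.Base as ℤ using (ℤ; 0ℤ; 1ℤ)
import Data.Integer.Properties as ℤ
open import Data.List.Base using (List; []; _∷_; map; _++_; length; lookup; filter; allFin; upTo; applyUpTo; cartesianProductWith)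
open import Data.List.Membership.Propositional using (_∈_)
open import Data.List.Membership.Propositional.Properties using (∈-lookup; ∈-map⁺; ∈-map⁻; ∈-++⁺ˡ; ∈-++⁺ʳ; ∈-++⁻; ∈-filter⁺; ∈-filter⁻; ∈-allFin; ∈-cartesianProductWith⁺; ∈-upTo⁺; ∈-upTo⁻)
open import Data.List.Membership.Propositional.Properties.WithK using (unique∧set⇒bag)
import Data.List.Membership.Setoid.Properties as MembershipS
open import Data.List.Properties using (length-map; length-++; map-∘; map-upTo)
open import Data.List.Relation.Binary.BagAndSetEquality using (∼bag⇒↭)
open import Data.List.Relation.Binary.Permutation.Propositional using (_↭_; ↭⇒↭ₛ′)
import Data.List.Relation.Binary.Permutation.Propositional.Properties as Perm
import Data.List.Relation.Binary.Permutation.Setoid.Properties as PermS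
open import Data.List.Relation.Unary.All as All using (All; [])
open import Data.List.Relation.Unary.Any using (here; there; index)
open import Data.List.Relation.Unary.Any.Properties using (lookup-index)
open import Data.List.Relation.Unary.Unique.Propositional using (Unique; []; _∷_)
import Data.List.Relation.Unary.Unique.Propositional.Properties as Unique
import Data.List.Relation.Unary.Unique.Setoid.Properties as UniqueS
open import Data.Nat.Base as ℕ using (ℕ; zero; suc; _∸_; _⊔_)
import Data.Nat.Properties as ℕ
open import Data.Product.Base using (_×_; _,_; ∃; proj₁; proj₂; map₁)
open import Data.Sum.Base using (inj₁; inj₂)
open import Data.Vec.Base as Vec using (Vec; []; _∷_; tabulate)
open import Data.Vec.Properties using (∷-injective; lookup∘tabulate; tabulate∘lookup; tabulate-cong)
open import Function.Base using (_∘_)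
open import Function.Bundles using (mk⇔; Equivalence)
open import Relation.Binary.Bundles using (Setoid)
open import Relation.Binary.Construct.Closure.ReflexiveTransitive using (Star; ε; _◅_; _◅◅_; gmap; reverse)
open import Relation.Binary.PropositionalEquality as ≡ using (_≡_; _≗_; refl; sym; trans; cong; cong₂; subst; module ≡-Reasoning)
import Relation.Binary.Reasoning.Setoid as SetoidReasoning
open import Relation.Binary.Structures using (IsEquivalence)
open import Relation.Nullary.Decidable using (Dec; yes; no; _×-dec_; ¬?; ⌊_⌋; toWitness; decidable-stable)
open import Relation.Nullary.Negation using (¬_; contradiction)
open import Relation.Unary using (Decidable)

private
  variable
    n k m : ℕ
    A B : Set
    p p′ q q′ : Poly
    G : Graph

lookup-injective : ∀ {xs : List A} → Unique xs → ∀ {i j} → lookup xs i ≡ lookup xs j → i ≡ j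
lookup-injective (_ ∷ _) {zero} {zero} _ = refl
lookup-injective (x∉ ∷ _) {zero} {suc j} e = contradiction e (All.lookup x∉ (∈-lookup j))
lookup-injective (x∉ ∷ _) {suc i} {zero} e = contradiction (sym e) (All.lookup x∉ (∈-lookup i))
lookup-injective (_ ∷ u) {suc i} {suc j} e = cong suc (lookup-injective u e)

-- Colored partitions and vertex colorings

vertexColour : ColoredPartition k G → Graph.Vertex G → Fin k
vertexColour T = colour ∘ index′
  where open ColoredPartition T renaming (index to index′)

module _ {k : ℕ} {G : Graph} where
  open Graph G
  open ColoredPartition using () renaming (index to blockOf)

  -- Properness read contrapositively; equality of block indices is decidable, so the double
  -- negation can be removed.
  adjacent⇒sameBlock : ∀ (T : ColoredPartition k G) {u v} → Adj u v →
                       vertexColour T u ≡ vertexColour T v → blockOf T u ≡ blockOf T v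
  adjacent⇒sameBlock T {u} {v} uv c≡ = decidable-stable (_ Fin.≟ _) λ i≢j →
    ColoredPartition.proper T i≢j (u , v , refl , refl , uv) c≡

  -- A block is connected, so two of its vertices are joined by a walk of constant color. The color
  -- is constant under `T′` as well, so the walk never changes its block of `T′`.
  sameBlock-transfer : ∀ (T T′ : ColoredPartition k G) → vertexColour T ≗ vertexColour T′ →
                       ∀ u v → blockOf T u ≡ blockOf T v → blockOf T′ u ≡ blockOf T′ v
  sameBlock-transfer T T′ c≗ u v u~v = along (ColoredPartition.connected T _ u~v refl)
    where
    along : ∀ {u v i} → Star (λ a b → blockOf T a ≡ i × blockOf T b ≡ i × Adj a b) u v →
            blockOf T′ u ≡ blockOf T′ v
    along ε = refl
    along ((a∈ , b∈ , ab) ◅ p) = trans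
      (adjacent⇒sameBlock T′ ab
        (trans (sym (c≗ _)) (trans (cong (ColoredPartition.colour T) (trans a∈ (sym b∈))) (c≗ _))))
      (along p)

  sameColours⇒≋ : ∀ (T T′ : ColoredPartition k G) → vertexColour T ≗ vertexColour T′ → T ≋ T′
  sameColours⇒≋ T T′ c≗ =
    (λ u v → mk⇔ (sameBlock-transfer T T′ c≗ u v)
                 (sameBlock-transfer T′ T (sym ∘ c≗) u v)) , c≗

  -- Sending each block to the block of the other partition that contains a chosen vertex of it is
  -- injective in both directions.
  ≋⇒size≡ : ∀ (T T′ : ColoredPartition k G) → T ≋ T′ → size T ≡ size T′
  ≋⇒size≡ T T′ T≋T′ = Fin.cantor-schröder-bernstein
    (transport-injective T T′ (λ u v → Equivalence.from (proj₁ T≋T′ u v)))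
    (transport-injective T′ T (λ u v → Equivalence.to (proj₁ T≋T′ u v)))
    where
    transport-injective : ∀ (T T′ : ColoredPartition k G) →
      (∀ u v → blockOf T′ u ≡ blockOf T′ v → blockOf T u ≡ blockOf T v) →
      ∀ {i j} → blockOf T′ (proj₁ (ColoredPartition.nonempty T i))
              ≡ blockOf T′ (proj₁ (ColoredPartition.nonempty T j)) → i ≡ j
    transport-injective T T′ back {i} {j} e =
      trans (sym (proj₂ (ColoredPartition.nonempty T i)))
        (trans (back _ _ e) (proj₂ (ColoredPartition.nonempty T j)))

  -- A labelling gives a colored partition when its classes are the monochromatic components; the
  -- last two hypotheses are the two inclusions. As `labels` has no repetitions, positions in it
  -- serve as block numbers and its length counts the blocks.
  module _ {L : Set} (labels : List L) (labels! : Unique labels) (label : Vertex → L)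
           (label∈ : ∀ v → label v ∈ labels) (inhabited : ∀ {l} → l ∈ labels → ∃ λ v → label v ≡ l)
           (labelColour : L → Fin k)
           (adjacent⇒label≡ : ∀ {u v} → Adj u v → labelColour (label u) ≡ labelColour (label v) →
                              label u ≡ label v)
           (label≡⇒walk : ∀ {u v} → label u ≡ label v →
              Star (λ a b → Adj a b × labelColour (label a) ≡ labelColour (label b)) u v)
           where

    private
      lookup-label : ∀ v → lookup labels (index (label∈ v)) ≡ label v
      lookup-label v = sym (lookup-index (label∈ v))

      index≡⇒label≡ : ∀ {u i} → index (label∈ u) ≡ i → label u ≡ lookup labels i
      index≡⇒label≡ {u} refl = sym (lookup-label u)

      label≡⇒index≡ : ∀ {u i} → label u ≡ lookup labels i → index (label∈ u) ≡ i
      label≡⇒index≡ {u} e = lookup-injective labels! (trans (lookup-label u) e)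

      -- Each step preserves the color, hence the label, so the walk cannot leave the class it
      -- starts in.
      walk-within : ∀ {u v l} → label u ≡ lookup labels l →
        Star (λ a b → Adj a b × labelColour (label a) ≡ labelColour (label b)) u v →
        Star (λ a b → index (label∈ a) ≡ l × index (label∈ b) ≡ l × Adj a b) u v
      walk-within e ε = ε
      walk-within e ((ab , c≡) ◅ p) =
        (label≡⇒index≡ e , label≡⇒index≡ e′ , ab) ◅ walk-within e′ p
        where e′ = trans (sym (adjacent⇒label≡ ab c≡)) e

    labelPartition : ColoredPartition k G
    labelPartition = record
      { size      = length labels
      ; index     = λ v → index (label∈ v)
      ; colour    = labelColour ∘ lookup labels
      ; nonempty  = λ i → let v , e = inhabited (∈-lookup i) in v , label≡⇒index≡ e
      ; connected = λ i u∈ v∈ → walk-within (index≡⇒label≡ u∈)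
          (label≡⇒walk (trans (index≡⇒label≡ u∈) (sym (index≡⇒label≡ v∈))))
      ; proper    = λ { i≢j (u , v , u∈ , v∈ , uv) c≡ → i≢j (trans (sym u∈) (trans
          (label≡⇒index≡ (trans
            (adjacent⇒label≡ uv (trans (cong labelColour (index≡⇒label≡ u∈))
              (trans c≡ (cong labelColour (sym (index≡⇒label≡ v∈))))))
            (index≡⇒label≡ refl))) v∈)) }
      }

-- The monochromatic components of a coloring of K m □ P n

Column : ℕ → ℕ → Set
Column k m = Vec (Fin k) m

hue : Vec (Column k m) n → Fin m × Fin n → Fin k
hue cs (i , j) = Vec.lookup (Vec.lookup cs j) i

Occurs : Fin k → Column k m → Set
Occurs a c = ∃ λ i → Vec.lookup c i ≡ a

occurs? : ∀ (a : Fin k) (c : Column k m) → Dec (Occurs a c)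
occurs? a c = Fin.any? λ i → Vec.lookup c i Fin.≟ a

-- Edges between columns stay in one row, so the component of color `a` in `c` extends to the next
-- column exactly when some row carries `a` in both.
Linked : Fin k → Column k m → Vec (Column k m) n → Set
Linked a c []       = ⊥
Linked a c (c′ ∷ _) = ∃ λ i → Vec.lookup c i ≡ a × Vec.lookup c′ i ≡ a

linked? : ∀ (a : Fin k) (c : Column k m) (cs : Vec (Column k m) n) → Dec (Linked a c cs)
linked? a c []       = no λ ()
linked? a c (c′ ∷ _) = Fin.any? λ i → (Vec.lookup c i Fin.≟ a) ×-dec (Vec.lookup c′ i Fin.≟ a)

Fresh : Column k m → Vec (Column k m) n → Fin k → Set
Fresh c cs a = Occurs a c × ¬ Linked a c cs

fresh? : ∀ (c : Column k m) (cs : Vec (Column k m) n) → Decidable (Fresh c cs)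
fresh? c cs a = occurs? a c ×-dec ¬? (linked? a c cs)

fresh : Column k m → Vec (Column k m) n → List (Fin k)
fresh {k} c cs = filter (fresh? c cs) (allFin k)

-- A component occupies consecutive columns. It is labelled by its color and
-- the last of these columns.
reach₀ : Fin k → Column k m → Vec (Column k m) n → Fin (suc n)
reach₀ a c []        = zero
reach₀ a c (c′ ∷ cs) with linked? a c (c′ ∷ cs)
... | yes _ = suc (reach₀ a c′ cs)
... | no  _ = zero

reach : Fin k → Vec (Column k m) n → Fin n → Fin n
reach a (c ∷ cs) zero    = reach₀ a c cs
reach a (c ∷ cs) (suc j) = suc (reach a cs j)

label : Vec (Column k m) n → Fin m × Fin n → Fin n × Fin k
label cs (i , j) = reach (hue cs (i , j)) cs j , hue cs (i , j)

-- A component that meets `cs` keeps its last column, whose index grows by one when `c` is put in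
-- front. The other components lie entirely in `c`, one for each fresh color.
labels : Vec (Column k m) n → List (Fin n × Fin k)
labels []       = []
labels (c ∷ cs) = map (map₁ suc) (labels cs) ++ map (zero ,_) (fresh c cs)

labels-unique : (cs : Vec (Column k m) n) → Unique (labels cs)
labels-unique []       = []
labels-unique {k} (c ∷ cs) = Unique.++⁺
  (Unique.map⁺ (λ { {_ , _} {_ , _} refl → refl }) (labels-unique cs))
  (Unique.map⁺ (λ { refl → refl }) (Unique.filter⁺ (fresh? c cs) (Unique.allFin⁺ k)))
  (λ (p , q) → disjoint (proj₂ (proj₂ (∈-map⁻ _ p))) (proj₂ (proj₂ (∈-map⁻ _ q))))
  where
  disjoint : ∀ {l : Fin _ × Fin k} {l₁ a} → l ≡ map₁ suc l₁ → ¬ (l ≡ (zero , a))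
  disjoint refl ()

reach₀∈labels : ∀ (c : Column k m) (cs : Vec (Column k m) n) {a} → Occurs a c →
                (reach₀ a c cs , a) ∈ labels (c ∷ cs)
reach₀∈labels c [] {a} o =
  ∈-map⁺ (zero ,_) (∈-filter⁺ (fresh? c []) (∈-allFin a) (o , λ ()))
reach₀∈labels c (c′ ∷ cs) {a} o with linked? a c (c′ ∷ cs)
... | yes (i , _ , e) = ∈-++⁺ˡ (∈-map⁺ (map₁ suc) (reach₀∈labels c′ cs (i , e)))
... | no ¬l = ∈-++⁺ʳ (map (map₁ suc) (labels (c′ ∷ cs)))
  (∈-map⁺ (zero ,_) (∈-filter⁺ (fresh? c (c′ ∷ cs)) (∈-allFin a) (o , ¬l)))

reach∈labels : ∀ (cs : Vec (Column k m) n) j {a} → Occurs a (Vec.lookup cs j) →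
               (reach a cs j , a) ∈ labels cs
reach∈labels (c ∷ cs) zero    o = reach₀∈labels c cs o
reach∈labels (c ∷ cs) (suc j) o = ∈-++⁺ˡ (∈-map⁺ (map₁ suc) (reach∈labels cs j o))

reach₀-fresh : ∀ (c : Column k m) (cs : Vec (Column k m) n) {a} →
               ¬ Linked a c cs → reach₀ a c cs ≡ zero
reach₀-fresh c []        ¬l = refl
reach₀-fresh c (c′ ∷ cs) {a} ¬l with linked? a c (c′ ∷ cs)
... | yes l = contradiction l ¬l
... | no  _ = refl

labels-inhabited : ∀ (cs : Vec (Column k m) n) {l} → l ∈ labels cs → ∃ λ v → label cs v ≡ l
labels-inhabited (c ∷ cs) l∈ with ∈-++⁻ (map (map₁ suc) (labels cs)) l∈
... | inj₁ p with l′ , l′∈ , refl ← ∈-map⁻ (map₁ suc) p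
             with (i , j) , e ← labels-inhabited cs l′∈ =
                  (i , suc j) , cong (map₁ suc) e
-- A fresh color occurs in some row of the first column and is not linked, so its reach from there
-- is `zero`.
... | inj₂ p with a , a∈ , refl ← ∈-map⁻ (zero ,_) p
             with _ , (i , refl) , ¬l ← ∈-filter⁻ (fresh? c cs) {xs = allFin _} a∈ =
                  (i , zero) , cong (_, _) (reach₀-fresh c cs ¬l)

-- Walks inside a component.

module _ {k m : ℕ} where

  Step : Vec (Column k m) n → Fin m × Fin n → Fin m × Fin n → Set
  Step {n} cs u v = Graph.Adj (K m □ P n) u v × hue cs u ≡ hue cs v

  step-sym : ∀ {cs : Vec (Column k m) n} {u v} → Step cs u v → Step cs v u
  step-sym {n} (uv , e) = Graph.adj-sym (K m □ P n) uv , sym e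

  shift : Fin m × Fin n → Fin m × Fin (suc n)
  shift (i , j) = i , suc j

  step-shift : ∀ {c} {cs : Vec (Column k m) n} {u v} → Step cs u v → Step (c ∷ cs) (shift u) (shift v)
  step-shift (inj₁ (i≡ , inj₁ s) , e) = inj₁ (i≡ , inj₁ (cong suc s)) , e
  step-shift (inj₁ (i≡ , inj₂ s) , e) = inj₁ (i≡ , inj₂ (cong suc s)) , e
  step-shift (inj₂ (j≡ , a) , e)      = inj₂ (cong suc j≡ , a) , e

  -- A column is a clique, so two of its vertices are equal or adjacent.
  column-walk : ∀ (cs : Vec (Column k m) n) {i i′ j} → hue cs (i , j) ≡ hue cs (i′ , j) →
                Star (Step cs) (i , j) (i′ , j)
  column-walk cs {i} {i′} e with i Fin.≟ i′
  ... | yes refl = ε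
  ... | no i≢i′  = (inj₂ (refl , i≢i′) , e) ◅ ε

  -- While the color is linked, the walk moves within the column to a linking row and crosses to the
  -- next column there. The row `i′` of arrival is the row of the last crossing, or `i` if there is
  -- none.
  walk-to-reach₀ : ∀ (c : Column k m) (cs : Vec (Column k m) n) i {a} → Vec.lookup c i ≡ a →
                   ∃ λ i′ → hue (c ∷ cs) (i′ , reach₀ a c cs) ≡ a ×
                            Star (Step (c ∷ cs)) (i , zero) (i′ , reach₀ a c cs)
  walk-to-reach₀ c [] i e = i , e , ε
  walk-to-reach₀ c (c′ ∷ cs) i {a} e with linked? a c (c′ ∷ cs)
  ... | no _ = i , e , ε
  ... | yes (i₁ , e₁ , e₁′) =
    let i′ , e′ , p = walk-to-reach₀ c′ cs i₁ e₁′ in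
    i′ , e′ , column-walk (c ∷ c′ ∷ cs) (trans e (sym e₁))
              ◅◅ (inj₁ (refl , inj₁ refl) , trans e₁ (sym e₁′))
              ◅ gmap shift (step-shift {c = c} {cs = c′ ∷ cs}) p

  walk-to-reach : ∀ (cs : Vec (Column k m) n) i j {a} → hue cs (i , j) ≡ a →
                  ∃ λ i′ → hue cs (i′ , reach a cs j) ≡ a ×
                           Star (Step cs) (i , j) (i′ , reach a cs j)
  walk-to-reach (c ∷ cs) i zero    e = walk-to-reach₀ c cs i e
  walk-to-reach (c ∷ cs) i (suc j) e =
    let i′ , e′ , p = walk-to-reach cs i j e in i′ , e′ , gmap shift (step-shift {c = c} {cs = cs}) p

  -- Equal labels mean equal color and equal last column. Both vertices have walks to that column,
  -- and inside it `column-walk` joins the two ends.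
  label≡⇒walk : ∀ (cs : Vec (Column k m) n) {u v} → label cs u ≡ label cs v → Star (Step cs) u v
  label≡⇒walk cs {u@(i , j)} {v@(i′ , j′)} e
    with r , r-hue , p ← walk-to-reach cs i j refl
       | s , s-hue , q ← walk-to-reach cs i′ j′ refl =
    p ◅◅ join (cong proj₁ e) (trans r-hue (trans (cong proj₂ e) (sym s-hue))) ◅◅ reverse (step-sym {cs = cs}) q
    where
    join : ∀ {r s t t′} → t ≡ t′ → hue cs (r , t) ≡ hue cs (s , t′) → Star (Step cs) (r , t) (s , t′)
    join refl = column-walk cs

  -- The common row `i` witnesses that the color is linked, and for a linked color `reach₀`
  -- continues from the next column.
  reach-next : ∀ (cs : Vec (Column k m) n) i {j j′} {a} → toℕ j′ ≡ suc (toℕ j) →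
               hue cs (i , j) ≡ a → hue cs (i , j′) ≡ a → reach a cs j ≡ reach a cs j′
  reach-next (c ∷ cs) i {suc j} {suc j′} s e e′ = cong suc (reach-next cs i (ℕ.suc-injective s) e e′)
  reach-next (c ∷ c′ ∷ cs) i {zero} {suc zero} {a} s e e′ with linked? a c (c′ ∷ cs)
  ... | yes _ = refl
  ... | no ¬l = contradiction (i , e , e′) ¬l

  step⇒label≡ : ∀ (cs : Vec (Column k m) n) {u v} → Step cs u v → label cs u ≡ label cs v
  step⇒label≡ cs {i , j} (inj₁ (refl , inj₁ s) , e) =
    cong₂ _,_ (trans (reach-next cs i s refl (sym e)) (cong (λ a → reach a cs _) e)) e
  step⇒label≡ cs {i , j} (inj₁ (refl , inj₂ s) , e) =
    cong₂ _,_ (trans (sym (reach-next cs i s (sym e) refl)) (cong (λ a → reach a cs _) e)) e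
  step⇒label≡ cs (inj₂ (refl , _) , e) = cong (λ a → reach a cs _ , a) e

  -- The bijection between colorings and colored partitions.

  components : Vec (Column k m) n → ColoredPartition k (K m □ P n)
  components cs = labelPartition (labels cs) (labels-unique cs) (label cs)
    (λ (i , j) → reach∈labels cs j (i , refl)) (labels-inhabited cs) proj₂
    (λ uv e → step⇒label≡ cs (uv , e)) (label≡⇒walk cs)

  components-hue : (cs : Vec (Column k m) n) → vertexColour (components cs) ≗ hue cs
  components-hue cs (i , j) = cong proj₂ (sym (lookup-index (reach∈labels cs j (i , refl))))

  colouring : ColoredPartition k (K m □ P n) → Vec (Column k m) n
  colouring T = tabulate λ j → tabulate λ i → vertexColour T (i , j)

  hue-colouring : (T : ColoredPartition k (K m □ P n)) → hue (colouring T) ≗ vertexColour T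
  hue-colouring T (i , j) rewrite lookup∘tabulate (λ j → tabulate λ i → vertexColour T (i , j)) j =
    lookup∘tabulate (λ i → vertexColour T (i , j)) i

  hue-injective : ∀ {cs cs′ : Vec (Column k m) n} → hue cs ≗ hue cs′ → cs ≡ cs′
  hue-injective {cs = cs} {cs′} h = lookup-ext λ j → lookup-ext λ i → h (i , j)
    where
    lookup-ext : ∀ {A : Set} {n} {xs ys : Vec A n} → Vec.lookup xs ≗ Vec.lookup ys → xs ≡ ys
    lookup-ext {xs = xs} {ys} e =
      trans (sym (tabulate∘lookup xs)) (trans (tabulate-cong e) (tabulate∘lookup ys))

  components-colouring : (T : ColoredPartition k (K m □ P n)) → components (colouring T) ≋ T
  components-colouring T = sameColours⇒≋ (components (colouring T)) T λ v →
    trans (components-hue (colouring T) v) (hue-colouring T v)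

  components-injective : ∀ (cs cs′ : Vec (Column k m) n) → components cs ≋ components cs′ → cs ≡ cs′
  components-injective cs cs′ (_ , c≗) = hue-injective λ v →
    trans (sym (components-hue cs v)) (trans (c≗ v) (components-hue cs′ v))

  colouring-injective : ∀ {T T′ : ColoredPartition k (K m □ P n)} → colouring T ≡ colouring T′ → T ≋ T′
  colouring-injective {T = T} {T′} e = sameColours⇒≋ T T′ λ v →
    trans (sym (hue-colouring T v)) (trans (cong (λ cs → hue cs v) e) (hue-colouring T′ v))

  colouring-components : (cs : Vec (Column k m) n) → colouring (components cs) ≡ cs
  colouring-components cs = hue-injective λ v → trans (hue-colouring (components cs) v) (components-hue cs v)

-- Exhaustive lists of colorings and of colored partitions.

words : ∀ {A : Set} → List A → ∀ n → List (Vec A n)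
words xs zero    = [] ∷ []
words xs (suc n) = cartesianProductWith _∷_ xs (words xs n)

words-complete : ∀ {A : Set} {xs : List A} → (∀ a → a ∈ xs) → ∀ {n} (v : Vec A n) → v ∈ words xs n
words-complete all []      = here refl
words-complete all (a ∷ v) = ∈-cartesianProductWith⁺ _∷_ (all a) (words-complete all v)

words-unique : ∀ {A : Set} {xs : List A} → Unique xs → ∀ n → Unique (words xs n)
words-unique xs! zero    = [] ∷ []
words-unique xs! (suc n) = Unique.cartesianProductWith⁺ _∷_ ∷-injective xs! (words-unique xs! n)

columns : ∀ k m → List (Column k m)
columns k m = words (allFin k) m

colourings : ∀ k m n → List (Vec (Column k m) n)
colourings k m n = words (columns k m) n

colourings-complete : (cs : Vec (Column k m) n) → cs ∈ colourings k m n
colourings-complete = words-complete (words-complete ∈-allFin)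

colourings-unique : ∀ k m n → Unique (colourings k m n)
colourings-unique k m n = words-unique (words-unique (Unique.allFin⁺ k) m) n

-- Colorings correspond one to one to colored partitions up to `≋`, so a list of all colorings
-- yields a listing. A statement about every family of listings is therefore not vacuous.
listing : ∀ k m n → Listing (𝒯 k (K m □ P n))
listing k m n = record
  { elements = map components (colourings k m n)
  ; complete = λ T → MembershipS.∈-resp-≈ 𝒯ₛ {x = components (colouring T)} {y = T}
      (components-colouring T)
      (MembershipS.∈-map⁺ (≡.setoid _) 𝒯ₛ components-cong (colourings-complete (colouring T)))
  ; unique   = UniqueS.map⁺ (≡.setoid _) 𝒯ₛ (components-injective _ _) (colourings-unique k m n)
  }
  where
  𝒯ₛ = 𝒯 k (K m □ P n)

  components-cong : ∀ {cs cs′ : Vec (Column k m) n} → cs ≡ cs′ → components cs ≋ components cs′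
  components-cong {cs} refl = Setoid.refl 𝒯ₛ {components cs}

-- Polynomials in y

-- A record, so that the two polynomials can be inferred from the type.
infix 4 _≐_
record _≐_ (p q : Poly) : Set where
  constructor coeffwise
  field at : p ≈ₚ q
open _≐_

≐-isEquivalence : IsEquivalence _≐_
≐-isEquivalence = record
  { refl  = coeffwise λ _ → refl
  ; sym   = λ e → coeffwise λ r → sym (at e r)
  ; trans = λ e f → coeffwise λ r → trans (at e r) (at f r)
  }

coeff-+ : ∀ p q r → coeff (p +ₚ q) r ≡ coeff p r ℤ.+ coeff q r
coeff-+ []      q       r       = sym (ℤ.+-identityˡ _)
coeff-+ (a ∷ p) []      r       = sym (ℤ.+-identityʳ _)
coeff-+ (a ∷ p) (b ∷ q) zero    = refl
coeff-+ (a ∷ p) (b ∷ q) (suc r) = coeff-+ p q r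

infixr 7 _·_
_·_ : ℤ → Poly → Poly
a · p = map (a ℤ.*_) p

coeff-· : ∀ a p r → coeff (a · p) r ≡ a ℤ.* coeff p r
coeff-· a []      r       = sym (ℤ.*-zeroʳ a)
coeff-· a (b ∷ p) zero    = refl
coeff-· a (b ∷ p) (suc r) = coeff-· a p r

+ₚ-cong : p ≐ p′ → q ≐ q′ → p +ₚ q ≐ p′ +ₚ q′
+ₚ-cong {p} {p′} {q} {q′} e f = coeffwise λ r →
  trans (coeff-+ p q r) (trans (cong₂ ℤ._+_ (at e r) (at f r)) (sym (coeff-+ p′ q′ r)))

+ₚ-assoc : ∀ p q s → (p +ₚ q) +ₚ s ≐ p +ₚ (q +ₚ s)
+ₚ-assoc p q s = coeffwise λ r → begin
  coeff ((p +ₚ q) +ₚ s) r                   ≡⟨ coeff-+ (p +ₚ q) s r ⟩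
  coeff (p +ₚ q) r ℤ.+ coeff s r            ≡⟨ cong (ℤ._+ _) (coeff-+ p q r) ⟩
  (coeff p r ℤ.+ coeff q r) ℤ.+ coeff s r   ≡⟨ ℤ.+-assoc (coeff p r) _ _ ⟩
  coeff p r ℤ.+ (coeff q r ℤ.+ coeff s r)   ≡⟨ cong (ℤ._+_ (coeff p r)) (coeff-+ q s r) ⟨
  coeff p r ℤ.+ coeff (q +ₚ s) r            ≡⟨ coeff-+ p (q +ₚ s) r ⟨
  coeff (p +ₚ (q +ₚ s)) r                   ∎
  where open ≡-Reasoning

+ₚ-comm : ∀ p q → p +ₚ q ≐ q +ₚ p
+ₚ-comm p q = coeffwise λ r →
  trans (coeff-+ p q r) (trans (ℤ.+-comm (coeff p r) _) (sym (coeff-+ q p r)))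

+ₚ-identityʳ : ∀ p → p +ₚ 0ₚ ≐ p
+ₚ-identityʳ p = coeffwise λ r → trans (coeff-+ p [] r) (ℤ.+-identityʳ _)

+ₚ-isCommutativeMonoid : IsCommutativeMonoid _≐_ _+ₚ_ 0ₚ
+ₚ-isCommutativeMonoid = record
  { isMonoid = record
    { isSemigroup = record
      { isMagma = record { isEquivalence = ≐-isEquivalence ; ∙-cong = +ₚ-cong }
      ; assoc   = +ₚ-assoc
      }
    ; identity = (λ _ → IsEquivalence.refl ≐-isEquivalence) , +ₚ-identityʳ
    }
  ; comm = +ₚ-comm
  }

+ₚ-commutativeMonoid : CommutativeMonoid _ _
+ₚ-commutativeMonoid = record { isCommutativeMonoid = +ₚ-isCommutativeMonoid }

open CommutativeMonoid +ₚ-commutativeMonoid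
  using (setoid) renaming (refl to ≐-refl; sym to ≐-sym; trans to ≐-trans; reflexive to ≐-reflexive)
open CommutativeSemigroup
  (CommutativeMonoid.commutativeSemigroup +ₚ-commutativeMonoid) using (interchange)
open SetoidReasoning setoid

∷-cong : ∀ {a} → p ≐ q → a ∷ p ≐ a ∷ q
∷-cong e = coeffwise λ { zero → refl ; (suc r) → at e r }

0∷0≐0 : 0ℤ ∷ 0ₚ ≐ 0ₚ
0∷0≐0 = coeffwise λ { zero → refl ; (suc r) → refl }

·-cong : ∀ a → p ≐ q → a · p ≐ a · q
·-cong {p} {q} a e = coeffwise λ r →
  trans (coeff-· a p r) (trans (cong (a ℤ.*_) (at e r)) (sym (coeff-· a q r)))

·-distribˡ : ∀ a p q → a · (p +ₚ q) ≐ a · p +ₚ a · q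
·-distribˡ a []      q       = ≐-refl
·-distribˡ a (b ∷ p) []      = ≐-refl
·-distribˡ a (b ∷ p) (c ∷ q) = coeffwise λ
  { zero → ℤ.*-distribˡ-+ a b c ; (suc r) → at (·-distribˡ a p q) r }

·-distribʳ : ∀ a b p → (a ℤ.+ b) · p ≐ a · p +ₚ b · p
·-distribʳ a b []      = ≐-refl
·-distribʳ a b (c ∷ p) = coeffwise λ
  { zero → ℤ.*-distribʳ-+ c a b ; (suc r) → at (·-distribʳ a b p) r }

·-assoc : ∀ a b p → (a ℤ.* b) · p ≐ a · b · p
·-assoc a b []      = ≐-refl
·-assoc a b (c ∷ p) = coeffwise λ
  { zero → ℤ.*-assoc a b c ; (suc r) → at (·-assoc a b p) r }

0·≐0 : ∀ p → 0ℤ · p ≐ 0ₚ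
0·≐0 p = coeffwise λ r → coeff-· 0ℤ p r

1·≐ : ∀ p → 1ℤ · p ≐ p
1·≐ p = coeffwise λ r → trans (coeff-· 1ℤ p r) (ℤ.*-identityˡ _)

*ₚ-congʳ : ∀ p → q ≐ q′ → p *ₚ q ≐ p *ₚ q′
*ₚ-congʳ []      e = ≐-refl
*ₚ-congʳ (a ∷ p) e = +ₚ-cong (·-cong a e) (∷-cong (*ₚ-congʳ p e))

*ₚ-zeroʳ : ∀ p → p *ₚ 0ₚ ≐ 0ₚ
*ₚ-zeroʳ []      = ≐-refl
*ₚ-zeroʳ (a ∷ p) = ≐-trans (∷-cong (*ₚ-zeroʳ p)) 0∷0≐0

*ₚ-distribˡ : ∀ p q s → p *ₚ (q +ₚ s) ≐ p *ₚ q +ₚ p *ₚ s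
*ₚ-distribˡ []      q s = ≐-refl
*ₚ-distribˡ (a ∷ p) q s = begin
  a · (q +ₚ s) +ₚ (0ℤ ∷ p *ₚ (q +ₚ s))
    ≈⟨ +ₚ-cong (·-distribˡ a q s) (∷-cong (*ₚ-distribˡ p q s)) ⟩
  (a · q +ₚ a · s) +ₚ ((0ℤ ∷ p *ₚ q) +ₚ (0ℤ ∷ p *ₚ s))
    ≈⟨ interchange (a · q) (a · s) (0ℤ ∷ p *ₚ q) (0ℤ ∷ p *ₚ s) ⟩
  (a · q +ₚ (0ℤ ∷ p *ₚ q)) +ₚ (a · s +ₚ (0ℤ ∷ p *ₚ s)) ∎

*ₚ-distribʳ : ∀ s p q → (p +ₚ q) *ₚ s ≐ p *ₚ s +ₚ q *ₚ s
*ₚ-distribʳ s []      q       = ≐-refl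
*ₚ-distribʳ s (a ∷ p) []      = ≐-sym (+ₚ-identityʳ _)
*ₚ-distribʳ s (a ∷ p) (b ∷ q) = begin
  (a ℤ.+ b) · s +ₚ (0ℤ ∷ (p +ₚ q) *ₚ s)
    ≈⟨ +ₚ-cong (·-distribʳ a b s) (∷-cong (*ₚ-distribʳ s p q)) ⟩
  (a · s +ₚ b · s) +ₚ ((0ℤ ∷ p *ₚ s) +ₚ (0ℤ ∷ q *ₚ s))
    ≈⟨ interchange (a · s) (b · s) (0ℤ ∷ p *ₚ s) (0ℤ ∷ q *ₚ s) ⟩
  (a · s +ₚ (0ℤ ∷ p *ₚ s)) +ₚ (b · s +ₚ (0ℤ ∷ q *ₚ s)) ∎

·-*ₚ : ∀ a p q → (a · p) *ₚ q ≐ a · (p *ₚ q)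
·-*ₚ a []      q = ≐-refl
·-*ₚ a (b ∷ p) q = begin
  (a ℤ.* b) · q +ₚ (0ℤ ∷ (a · p) *ₚ q) ≈⟨ +ₚ-cong (·-assoc a b q) (∷-cong (·-*ₚ a p q)) ⟩
  a · b · q +ₚ (0ℤ ∷ a · (p *ₚ q))     ≈⟨ +ₚ-cong ≐-refl (≐-reflexive (cong (_∷ a · (p *ₚ q)) (ℤ.*-zeroʳ a))) ⟨
  a · b · q +ₚ a · (0ℤ ∷ p *ₚ q)       ≈⟨ ·-distribˡ a (b · q) (0ℤ ∷ p *ₚ q) ⟨
  a · (b · q +ₚ (0ℤ ∷ p *ₚ q))         ∎

*ₚ-assoc : ∀ p q s → (p *ₚ q) *ₚ s ≐ p *ₚ (q *ₚ s)
*ₚ-assoc []      q s = ≐-refl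
*ₚ-assoc (a ∷ p) q s = begin
  (a · q +ₚ (0ℤ ∷ p *ₚ q)) *ₚ s
    ≈⟨ *ₚ-distribʳ s (a · q) (0ℤ ∷ p *ₚ q) ⟩
  (a · q) *ₚ s +ₚ (0ℤ · s +ₚ (0ℤ ∷ (p *ₚ q) *ₚ s))
    ≈⟨ +ₚ-cong (·-*ₚ a q s) (+ₚ-cong (0·≐0 s) (∷-cong (*ₚ-assoc p q s))) ⟩
  a · (q *ₚ s) +ₚ (0ℤ ∷ p *ₚ (q *ₚ s)) ∎

*ₚ-identityˡ : ∀ p → 1ₚ *ₚ p ≐ p
*ₚ-identityˡ p = begin
  1ℤ · p +ₚ (0ℤ ∷ []) ≈⟨ +ₚ-cong (1·≐ p) 0∷0≐0 ⟩
  p +ₚ 0ₚ             ≈⟨ +ₚ-identityʳ p ⟩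
  p                   ∎

*ₚ-identityʳ : ∀ p → p *ₚ 1ₚ ≐ p
*ₚ-identityʳ []      = ≐-refl
*ₚ-identityʳ (a ∷ p) = coeffwise λ
  { zero → trans (ℤ.+-identityʳ _) (ℤ.*-identityʳ a) ; (suc r) → at (*ₚ-identityʳ p) r }

-- A list of zeros of any length represents zero, so `p` need not be empty; the induction strips its
-- zero coefficients one by one.
*ₚ-zeroˡ : ∀ s → p ≐ 0ₚ → p *ₚ s ≐ 0ₚ
*ₚ-zeroˡ {[]}    s e = ≐-refl
*ₚ-zeroˡ {a ∷ p} s e rewrite at e 0 = begin
  0ℤ · s +ₚ (0ℤ ∷ p *ₚ s) ≈⟨ +ₚ-cong (0·≐0 s) (∷-cong (*ₚ-zeroˡ {p} s (coeffwise (at e ∘ suc)))) ⟩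
  0ℤ ∷ 0ₚ                 ≈⟨ 0∷0≐0 ⟩
  0ₚ                      ∎

*ₚ-congˡ : ∀ s → p ≐ q → p *ₚ s ≐ q *ₚ s
*ₚ-congˡ {[]}    {q}     s e = ≐-sym (*ₚ-zeroˡ s (≐-sym e))
*ₚ-congˡ {a ∷ p} {[]}    s e = *ₚ-zeroˡ s e
*ₚ-congˡ {a ∷ p} {b ∷ q} s e rewrite at e 0 =
  +ₚ-cong ≐-refl (∷-cong (*ₚ-congˡ {p} {q} s (coeffwise (at e ∘ suc))))

^ₚ-+ : ∀ p i j → p ^ₚ (i ℕ.+ j) ≐ p ^ₚ i *ₚ p ^ₚ j
^ₚ-+ p zero    j = ≐-sym (*ₚ-identityˡ _)
^ₚ-+ p (suc i) j = ≐-trans (*ₚ-congʳ p (^ₚ-+ p i j)) (≐-sym (*ₚ-assoc p (p ^ₚ i) (p ^ₚ j)))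

-- Comparison up to trailing zeros. Being Boolean, it settles identities between closed polynomials
-- by evaluation.
agree : Poly → Poly → Bool
agree []      []      = true
agree []      (b ∷ q) = ⌊ b ℤ.≟ 0ℤ ⌋ ∧ agree [] q
agree (a ∷ p) []      = ⌊ a ℤ.≟ 0ℤ ⌋ ∧ agree p []
agree (a ∷ p) (b ∷ q) = ⌊ a ℤ.≟ b ⌋ ∧ agree p q

agree-sound : ∀ p q → T (agree p q) → p ≐ q
agree-sound []      []      _ = ≐-refl
agree-sound []      (b ∷ q) t with u , v ← Equivalence.to T-∧ t = coeffwise λ
  { zero → sym (toWitness u) ; (suc r) → at (agree-sound [] q v) r }
agree-sound (a ∷ p) []      t with u , v ← Equivalence.to T-∧ t = coeffwise λ
  { zero → toWitness u ; (suc r) → at (agree-sound p [] v) r }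
agree-sound (a ∷ p) (b ∷ q) t with u , v ← Equivalence.to T-∧ t = coeffwise λ
  { zero → toWitness u ; (suc r) → at (agree-sound p q v) r }

-- Finite sums

∑ : List A → (A → Poly) → Poly
∑ xs f = sumₚ (map f xs)

∑-cong∈ : ∀ (xs : List A) {f g : A → Poly} → (∀ {a} → a ∈ xs → f a ≐ g a) → ∑ xs f ≐ ∑ xs g
∑-cong∈ []       e = ≐-refl
∑-cong∈ (a ∷ xs) e = +ₚ-cong (e (here refl)) (∑-cong∈ xs (e ∘ there))

∑-cong : ∀ (xs : List A) {f g : A → Poly} → (∀ a → f a ≐ g a) → ∑ xs f ≐ ∑ xs g
∑-cong xs e = ∑-cong∈ xs λ {a} _ → e a

∑-zero : ∀ (xs : List A) → ∑ xs (λ _ → 0ₚ) ≐ 0ₚ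
∑-zero []       = ≐-refl
∑-zero (_ ∷ xs) = ∑-zero xs

∑-+ : ∀ (xs : List A) (f g : A → Poly) → ∑ xs (λ a → f a +ₚ g a) ≐ ∑ xs f +ₚ ∑ xs g
∑-+ []       f g = ≐-refl
∑-+ (a ∷ xs) f g = ≐-trans (+ₚ-cong ≐-refl (∑-+ xs f g)) (interchange (f a) (g a) _ _)

∑-swap : ∀ (xs : List A) (ys : List B) (f : A → B → Poly) →
         ∑ xs (λ a → ∑ ys (f a)) ≐ ∑ ys (λ b → ∑ xs (λ a → f a b))
∑-swap []       ys f = ≐-sym (∑-zero ys)
∑-swap (a ∷ xs) ys f = ≐-trans (+ₚ-cong ≐-refl (∑-swap xs ys f)) (≐-sym (∑-+ ys (f a) _))

∑-*ₚ : ∀ (xs : List A) f q → ∑ xs f *ₚ q ≐ ∑ xs (λ a → f a *ₚ q)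
∑-*ₚ []       f q = ≐-refl
∑-*ₚ (a ∷ xs) f q = ≐-trans (*ₚ-distribʳ q (f a) _) (+ₚ-cong ≐-refl (∑-*ₚ xs f q))

*ₚ-∑ : ∀ p (xs : List A) f → p *ₚ ∑ xs f ≐ ∑ xs (λ a → p *ₚ f a)
*ₚ-∑ p []       f = *ₚ-zeroʳ p
*ₚ-∑ p (a ∷ xs) f = ≐-trans (*ₚ-distribˡ p (f a) _) (+ₚ-cong ≐-refl (*ₚ-∑ p xs f))

∑-++ : ∀ (xs ys : List A) f → ∑ (xs ++ ys) f ≐ ∑ xs f +ₚ ∑ ys f
∑-++ []       ys f = ≐-refl
∑-++ (a ∷ xs) ys f = ≐-trans (+ₚ-cong ≐-refl (∑-++ xs ys f)) (≐-sym (+ₚ-assoc (f a) _ _))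

∑-map : ∀ (g : A → B) xs f → ∑ (map g xs) f ≐ ∑ xs (f ∘ g)
∑-map g xs f = ≐-reflexive (cong sumₚ (sym (map-∘ xs)))

∑-cartesianProductWith : ∀ {C : Set} (g : A → B → C) xs ys f →
  ∑ (cartesianProductWith g xs ys) f ≐ ∑ xs (λ a → ∑ ys (λ b → f (g a b)))
∑-cartesianProductWith g []       ys f = ≐-refl
∑-cartesianProductWith g (a ∷ xs) ys f = ≐-trans (∑-++ (map (g a) ys) _ f)
  (+ₚ-cong (∑-map (g a) ys f) (∑-cartesianProductWith g xs ys f))

∑-↭ : ∀ {xs ys : List A} f → xs ↭ ys → ∑ xs f ≐ ∑ ys f
∑-↭ f xs↭ys = PermS.foldr-commMonoid setoid +ₚ-isCommutativeMonoid
  (↭⇒↭ₛ′ ≐-isEquivalence (Perm.map⁺ f xs↭ys))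

sumₚ-applyUpTo-+ : ∀ i j (f : ℕ → Poly) → sumₚ (applyUpTo f (i ℕ.+ j)) ≐
                   sumₚ (applyUpTo f i) +ₚ sumₚ (applyUpTo (λ t → f (i ℕ.+ t)) j)
sumₚ-applyUpTo-+ zero    j f = ≐-refl
sumₚ-applyUpTo-+ (suc i) j f = ≐-trans (+ₚ-cong ≐-refl (sumₚ-applyUpTo-+ i j (f ∘ suc)))
  (≐-sym (+ₚ-assoc (f 0) _ _))

-- The transfer matrix

module _ (k m : ℕ) where

  blocks : Vec (Column k m) n → ℕ
  blocks cs = length (labels cs)

  partitionPoly : ℕ → Poly
  partitionPoly n = ∑ (colourings k m n) λ cs → yₚ ^ₚ blocks cs

  private
    𝒯ₛ = λ n → 𝒯 k (K m □ P n)

  colouring-cong : ∀ {T T′ : ColoredPartition k (K m □ P n)} → T ≋ T′ → colouring T ≡ colouring T′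
  colouring-cong (_ , c≗) = tabulate-cong λ j → tabulate-cong λ i → c≗ (i , j)

  -- `colouring` turns `≋` into `≡`, so both lists are free of repetitions and have the same
  -- members. Hence the block polynomial does not depend on the listing.
  listing-↭ : (L : Listing (𝒯ₛ n)) → map colouring (Listing.elements L) ↭ colourings k m n
  listing-↭ {n} L = ∼bag⇒↭ (unique∧set⇒bag
    (UniqueS.map⁺ (𝒯ₛ n) (≡.setoid _) (λ {T} {T′} → colouring-injective {T = T} {T′}) (Listing.unique L))
    (colourings-unique k m n)
    (λ {cs} → mk⇔ (λ _ → colourings-complete cs) (λ _ → subst (_∈ _) (colouring-components cs)
      (MembershipS.∈-map⁺ (𝒯ₛ n) (≡.setoid _) (λ {T} {T′} → colouring-cong {T = T} {T′})
        {v = components cs}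
        (Listing.complete L (components cs))))))

  size≡blocks : (T : ColoredPartition k (K m □ P n)) → size T ≡ blocks (colouring T)
  size≡blocks T = sym (≋⇒size≡ (components (colouring T)) T (components-colouring T))

  blockPoly≐partitionPoly : (L : Listing (𝒯ₛ n)) → blockPoly L ≐ partitionPoly n
  blockPoly≐partitionPoly {n} L = begin
    ∑ Ts (λ T → yₚ ^ₚ size T)
      ≈⟨ ∑-cong Ts (λ T → ≐-reflexive (cong (yₚ ^ₚ_) (size≡blocks T))) ⟩
    ∑ Ts (λ T → yₚ ^ₚ blocks (colouring T))
      ≈⟨ ∑-map colouring Ts _ ⟨
    ∑ (map colouring Ts) (λ cs → yₚ ^ₚ blocks cs)
      ≈⟨ ∑-↭ _ (listing-↭ L) ⟩
    partitionPoly n ∎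
    where Ts = Listing.elements L

  -- The colorings counted have `suc n` columns: `c` and `n` more.
  startingWith : ℕ → Column k m → Poly
  startingWith n c = ∑ (colourings k m n) λ cs → yₚ ^ₚ blocks (c ∷ cs)

  -- Entry of the transfer matrix M in row `c` and column `c′`. The tail `c′ ∷ []` stands for every
  -- tail beginning with `c′`, since `Linked` inspects only the next column.
  weight : Column k m → Column k m → Poly
  weight c c′ = yₚ ^ₚ length (fresh c (c′ ∷ []))

  blocks-∷ : ∀ (c : Column k m) (cs : Vec (Column k m) n) →
             blocks (c ∷ cs) ≡ blocks cs ℕ.+ length (fresh c cs)
  blocks-∷ c cs = trans (length-++ (map _ (labels cs)))
    (cong₂ ℕ._+_ (length-map _ (labels cs)) (length-map _ (fresh c cs)))

  startingWith-suc : ∀ n c → startingWith (suc n) c ≐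
                     ∑ (columns k m) λ c′ → startingWith n c′ *ₚ weight c c′
  startingWith-suc n c = ≐-trans (∑-cartesianProductWith _∷_ (columns k m) (colourings k m n) _)
    (∑-cong (columns k m) λ c′ → begin
      ∑ (colourings k m n) (λ cs → yₚ ^ₚ blocks (c ∷ c′ ∷ cs))
        ≈⟨ ∑-cong (colourings k m n) (λ cs → ≐-trans
             (≐-reflexive (cong (yₚ ^ₚ_) (blocks-∷ c (c′ ∷ cs))))
             (^ₚ-+ yₚ (blocks (c′ ∷ cs)) _)) ⟩
      ∑ (colourings k m n) (λ cs → yₚ ^ₚ blocks (c′ ∷ cs) *ₚ weight c c′)
        ≈⟨ ∑-*ₚ (colourings k m n) _ (weight c c′) ⟨
      startingWith n c′ *ₚ weight c c′ ∎)

  -- The row vector (1, …, 1) times the j-th power of the matrix of weights.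
  row : ℕ → Column k m → Poly
  row zero    c′ = 1ₚ
  row (suc j) c′ = ∑ (columns k m) λ c → weight c c′ *ₚ row j c

  rowPairing : ℕ → ℕ → Poly
  rowPairing n j = ∑ (columns k m) λ c → startingWith n c *ₚ row j c

  -- The vector `startingWith (suc n)` is M times `startingWith n`; exchanging the sums lets M act
  -- on the row instead.
  rowPairing-suc : ∀ n j → rowPairing (suc n) j ≐ rowPairing n (suc j)
  rowPairing-suc n j = begin
    ∑ (columns k m) (λ c → startingWith (suc n) c *ₚ row j c)
      ≈⟨ ∑-cong (columns k m) (λ c → ≐-trans (*ₚ-congˡ (row j c) (startingWith-suc n c))
           (≐-trans (∑-*ₚ (columns k m) _ (row j c)) (∑-cong (columns k m) λ c′ →
             *ₚ-assoc (startingWith n c′) (weight c c′) (row j c)))) ⟩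
    ∑ (columns k m) (λ c → ∑ (columns k m) λ c′ → startingWith n c′ *ₚ (weight c c′ *ₚ row j c))
      ≈⟨ ∑-swap (columns k m) (columns k m) _ ⟩
    ∑ (columns k m) (λ c′ → ∑ (columns k m) λ c → startingWith n c′ *ₚ (weight c c′ *ₚ row j c))
      ≈⟨ ∑-cong (columns k m) (λ c′ → *ₚ-∑ (startingWith n c′) (columns k m) _) ⟨
    ∑ (columns k m) (λ c′ → startingWith n c′ *ₚ row (suc j) c′) ∎

  -- Shifting M onto the row `j` times expresses consecutive block polynomials through one and the
  -- same vector `startingWith n`.
  partitionPoly-row : ∀ n j → partitionPoly (suc n ℕ.+ j) ≐ rowPairing n j
  partitionPoly-row n zero = begin
    partitionPoly (suc (n ℕ.+ 0))
      ≡⟨ cong (partitionPoly ∘ suc) (ℕ.+-identityʳ n) ⟩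
    partitionPoly (suc n)
      ≈⟨ ∑-cartesianProductWith _∷_ (columns k m) (colourings k m n) _ ⟩
    ∑ (columns k m) (startingWith n)
      ≈⟨ ∑-cong (columns k m) (λ c → *ₚ-identityʳ _) ⟨
    rowPairing n 0 ∎
  partitionPoly-row n (suc j) = begin
    partitionPoly (suc n ℕ.+ suc j)   ≡⟨ cong (partitionPoly ∘ suc) (ℕ.+-suc n j) ⟩
    partitionPoly (suc (suc n) ℕ.+ j) ≈⟨ partitionPoly-row (suc n) j ⟩
    rowPairing (suc n) j              ≈⟨ rowPairing-suc n j ⟩
    rowPairing n (suc j)              ∎

-- Rational generating functions

Degree≤ : ℕ → Series → Set
Degree≤ d f = ∀ i → d ℕ.< i → f i ≐ 0ₚ

convolution : ∀ f g n → (f * g) n ≐ ∑ (upTo (suc n)) λ i → f i *ₚ g (n ∸ i)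
convolution f g n = ≐-reflexive (cong sumₚ (sym (map-upTo (λ i → f i *ₚ g (n ∸ i)) (suc n))))

degree-constant : ∀ p → Degree≤ 0 (constant p)
degree-constant p (suc i) _ = ≐-refl

degree-x : Degree≤ 1 x
degree-x (suc zero)    (ℕ.s≤s ())
degree-x (suc (suc i)) _ = ≐-refl

degree-+ : ∀ {d e f g} → Degree≤ d f → Degree≤ e g → Degree≤ (d ⊔ e) (f + g)
degree-+ {d} {e} f≤ g≤ i i> = +ₚ-cong (f≤ i (ℕ.m⊔n<o⇒m<o d e i>)) (g≤ i (ℕ.m⊔n<o⇒n<o d e i>))

degree-- : ∀ {d e f g} → Degree≤ d f → Degree≤ e g → Degree≤ (d ⊔ e) (f - g)
degree-- {d} {e} f≤ g≤ i i> = +ₚ-cong (f≤ i (ℕ.m⊔n<o⇒m<o d e i>))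
  (neg (g≤ i (ℕ.m⊔n<o⇒n<o d e i>)))
  where
  neg : ∀ {p} → p ≐ 0ₚ → -ₚ p ≐ 0ₚ
  neg {[]}    e = ≐-refl
  neg {a ∷ p} e rewrite at e 0 = ≐-trans (∷-cong (neg (coeffwise (at e ∘ suc)))) 0∷0≐0

-- In each term either `i` exceeds `d`, or `i` is at most `d` and then `n ∸ i` exceeds `e`.
degree-* : ∀ {d e f g} → Degree≤ d f → Degree≤ e g → Degree≤ (d ℕ.+ e) (f * g)
degree-* {d} {e} {f} {g} f≤ g≤ n n> = ≐-trans (convolution f g n)
  (≐-trans (∑-cong (upTo (suc n)) vanish) (∑-zero (upTo (suc n))))
  where
  vanish : ∀ i → f i *ₚ g (n ∸ i) ≐ 0ₚ
  vanish i with d ℕ.<? i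
  ... | yes d<i = *ₚ-zeroˡ (g (n ∸ i)) (f≤ i d<i)
  ... | no d≮i = ≐-trans (*ₚ-congʳ (f i) (g≤ (n ∸ i) e<n∸i)) (*ₚ-zeroʳ (f i))
    where
    e<n∸i : e ℕ.< n ∸ i
    e<n∸i = ℕ.m+n≤o⇒m≤o∸n (suc e) (ℕ.≤-trans
      (ℕ.s≤s (ℕ.≤-trans (ℕ.+-monoʳ-≤ e (ℕ.≮⇒≥ d≮i)) (ℕ.≤-reflexive (ℕ.+-comm e d)))) n>)

degree-^ : ∀ {d f} → Degree≤ d f → ∀ r → Degree≤ (r ℕ.* d) (f ^ r)
degree-^ f≤ zero    = degree-constant _
degree-^ f≤ (suc r) = degree-* f≤ (degree-^ f≤ r)

*-congˡ : ∀ {f f′} g → (∀ i → f i ≐ f′ i) → ∀ n → (f * g) n ≐ (f′ * g) n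
*-congˡ {f} {f′} g e n = ≐-trans (convolution f g n) (≐-trans
  (∑-cong (upTo (suc n)) λ i → *ₚ-congˡ (g (n ∸ i)) (e i)) (≐-sym (convolution f′ g n)))

-- The terms with index at most `n` meet coefficients of `g` beyond `d` and vanish. The remaining
-- `suc d` terms have index `suc n ℕ.+ j` in `f` and `d ∸ j` in `g`.
*-tail : ∀ {d} f {g} → Degree≤ d g → ∀ n → (f * g) (n ℕ.+ suc d) ≐
         ∑ (upTo (suc d)) λ j → f (suc n ℕ.+ j) *ₚ g (d ∸ j)
*-tail {d} f {g} g≤ n = begin
  (f * g) N
    ≈⟨ sumₚ-applyUpTo-+ (suc n) (suc d) term ⟩
  sumₚ (applyUpTo term (suc n)) +ₚ sumₚ (applyUpTo (λ j → term (suc n ℕ.+ j)) (suc d))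
    ≡⟨ cong₂ (λ l l′ → sumₚ l +ₚ sumₚ l′) (map-upTo term (suc n))
         (map-upTo (λ j → term (suc n ℕ.+ j)) (suc d)) ⟨
  ∑ (upTo (suc n)) term +ₚ ∑ (upTo (suc d)) (λ j → term (suc n ℕ.+ j))
    ≈⟨ +ₚ-cong (≐-trans (∑-cong∈ (upTo (suc n)) vanish) (∑-zero (upTo (suc n))))
         (∑-cong (upTo (suc d)) λ j → ≐-reflexive (cong (λ t → f (suc n ℕ.+ j) *ₚ g t) (reindex j))) ⟩
  ∑ (upTo (suc d)) (λ j → f (suc n ℕ.+ j) *ₚ g (d ∸ j)) ∎
  where
  N = n ℕ.+ suc d

  term : ℕ → Poly
  term i = f i *ₚ g (N ∸ i)

  vanish : ∀ {i} → i ∈ upTo (suc n) → term i ≐ 0ₚ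
  vanish {i} i∈ = ≐-trans (*ₚ-congʳ (f i) (g≤ (N ∸ i) d<N∸i)) (*ₚ-zeroʳ (f i))
    where
    d<N∸i : d ℕ.< N ∸ i
    d<N∸i = ℕ.m+n≤o⇒m≤o∸n (suc d) (ℕ.≤-trans
      (ℕ.+-monoʳ-≤ (suc d) (ℕ.<⇒≤pred (∈-upTo⁻ i∈))) (ℕ.≤-reflexive (ℕ.+-comm (suc d) n)))

  reindex : ∀ j → N ∸ (suc n ℕ.+ j) ≡ d ∸ j
  reindex j rewrite ℕ.+-suc n d = ℕ.[m+n]∸[m+o]≡n∸o n d j

-- The recurrence satisfied by the generating function.

genFun-shift : ∀ {k m} (L : ∀ n → Listing (𝒯 k (K m □ P n))) n j →
               genFun {m} {k} L (suc n ℕ.+ j) ≐ rowPairing k m n j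
genFun-shift {k} {m} L n j =
  ≐-trans (blockPoly≐partitionPoly k m (L (suc n ℕ.+ j))) (partitionPoly-row k m n j)

-- For fixed `k` and `m` these coefficients can be evaluated, unlike those of `genFun L` for an
-- arbitrary `L`.
rowSeries : ℕ → ℕ → Series
rowSeries k m zero    = 0ₚ
rowSeries k m (suc j) = rowPairing k m 0 j

genFun≐rowSeries : ∀ {k m} (L : ∀ n → Listing (𝒯 k (K m □ P n))) n →
                   genFun {m} {k} L n ≐ rowSeries k m n
genFun≐rowSeries L zero    = ≐-refl
genFun≐rowSeries L (suc j) = genFun-shift L 0 j

-- All coefficients involved are pairings with the same vector `startingWith n`, so one linear
-- relation among the rows, checked at each column `c`, serves for every `n`.
genFun-recurrence : ∀ {k m d} (L : ∀ n → Listing (𝒯 k (K m □ P n))) {g : Series} → Degree≤ d g →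
  (∀ c → ∑ (upTo (suc d)) (λ j → row k m j c *ₚ g (d ∸ j)) ≐ 0ₚ) →
  ∀ n → (genFun {m} {k} L * g) (n ℕ.+ suc d) ≐ 0ₚ
genFun-recurrence {k} {m} {d} L {g} g≤ annihilates n = begin
  (genFun L * g) (n ℕ.+ suc d)
    ≈⟨ *-tail (genFun L) g≤ n ⟩
  ∑ js (λ j → genFun L (suc n ℕ.+ j) *ₚ g (d ∸ j))
    ≈⟨ ∑-cong js (λ j → *ₚ-congˡ (g (d ∸ j)) (genFun-shift L n j)) ⟩
  ∑ js (λ j → rowPairing k m n j *ₚ g (d ∸ j))
    ≈⟨ ∑-cong js (λ j → ≐-trans (∑-*ₚ cols _ (g (d ∸ j)))
         (∑-cong cols λ c → *ₚ-assoc (startingWith k m n c) (row k m j c) (g (d ∸ j)))) ⟩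
  ∑ js (λ j → ∑ cols λ c → startingWith k m n c *ₚ (row k m j c *ₚ g (d ∸ j)))
    ≈⟨ ∑-swap js cols _ ⟩
  ∑ cols (λ c → ∑ js λ j → startingWith k m n c *ₚ (row k m j c *ₚ g (d ∸ j)))
    ≈⟨ ∑-cong cols (λ c → ≐-trans (≐-sym (*ₚ-∑ (startingWith k m n c) js _))
         (≐-trans (*ₚ-congʳ (startingWith k m n c) (annihilates c)) (*ₚ-zeroʳ (startingWith k m n c)))) ⟩
  ∑ cols (λ _ → 0ₚ)
    ≈⟨ ∑-zero cols ⟩
  0ₚ ∎
  where
  js   = upTo (suc d)
  cols = columns k m

-- The case of two colors and four rows.

numerator denominator : Series
numerator =
  # 2 * x * y * (# 1 + # 7 * y
                 - x * (y - # 1) * (# 7 * y ^ 2 + y - # 9)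
                 + x ^ 2 * (y - # 1) ^ 2 * (# 8 * y ^ 2 - # 17 * y + # 8))
denominator =
  # 1 - # 2 * x * (y ^ 2 + # 2 * y + # 5)
      + x ^ 2 * (y - # 1) * (y ^ 3 + # 6 * y ^ 2 + # 8 * y - # 17)
      - x ^ 3 * (y - # 1) ^ 2 * (y ^ 3 + # 6 * y ^ 2 - # 17 * y + # 8)

degree-# : ∀ a → Degree≤ 0 (# a)
degree-# a = degree-constant _

degree-y : Degree≤ 0 y
degree-y = degree-constant yₚ

degree-y-1 : Degree≤ 0 (y - # 1)
degree-y-1 = degree-- degree-y (degree-# 1)

degree-numerator : Degree≤ 3 numerator
degree-numerator =
  degree-* (degree-* (degree-* (degree-# 2) degree-x) degree-y)
    (degree-+
      (degree-- (degree-+ (degree-# 1) (degree-* (degree-# 7) degree-y))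
        (degree-* (degree-* degree-x degree-y-1)
          (degree-- (degree-+ (degree-* (degree-# 7) (degree-^ degree-y 2)) degree-y) (degree-# 9))))
      (degree-* (degree-* (degree-^ degree-x 2) (degree-^ degree-y-1 2))
        (degree-+ (degree-- (degree-* (degree-# 8) (degree-^ degree-y 2))
          (degree-* (degree-# 17) degree-y)) (degree-# 8))))

degree-denominator : Degree≤ 3 denominator
degree-denominator =
  degree--
    (degree-+
      (degree-- (degree-# 1)
        (degree-* (degree-* (degree-# 2) degree-x)
          (degree-+ (degree-+ (degree-^ degree-y 2) (degree-* (degree-# 2) degree-y)) (degree-# 5))))
      (degree-* (degree-* (degree-^ degree-x 2) degree-y-1)
        (degree-- (degree-+ (degree-+ (degree-^ degree-y 3) (degree-* (degree-# 6) (degree-^ degree-y 2)))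
          (degree-* (degree-# 8) degree-y)) (degree-# 17))))
    (degree-* (degree-* (degree-^ degree-x 3) (degree-^ degree-y-1 2))
      (degree-+ (degree-- (degree-+ (degree-^ degree-y 3) (degree-* (degree-# 6) (degree-^ degree-y 2)))
        (degree-* (degree-# 17) degree-y)) (degree-# 8)))

-- An identity of closed polynomials for each of the 16 columns, verified by evaluation.
denominator-annihilates : ∀ c → ∑ (upTo 4) (λ j → row 2 4 j c *ₚ denominator (3 ∸ j)) ≐ 0ₚ
denominator-annihilates c = agree-sound _ _ (All.lookup checked (words-complete ∈-allFin c))
  where
  checked : All (λ c → T (agree (∑ (upTo 4) λ j → row 2 4 j c *ₚ denominator (3 ∸ j)) 0ₚ)) (columns 2 4)
  -- Once the decision procedure evaluates to `yes`, the required witness has the unit type and is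
  -- filled in by `_`.
  checked = toWitness {a? = All.all? (λ c → T? _) (columns 2 4)} _

-- The recurrence starts at degree 4 in `x`; the four coefficients below it are computed.
initial-terms : ∀ {n} → n ∈ upTo 4 → (rowSeries 2 4 * denominator) n ≐ numerator n
initial-terms n∈ = agree-sound _ _ (All.lookup checked n∈)
  where
  checked : All (λ n → T (agree ((rowSeries 2 4 * denominator) n) (numerator n))) (upTo 4)
  checked = toWitness {a? = All.all? (λ n → T? _) (upTo 4)} _

theorem6p6 : (∀ n → Listing (𝒯 2 (K 4 □ P n))) ×
    ((L : ∀ n → Listing (𝒯 2 (K 4 □ P n))) →
    genFun {4} {2} L
    ≈ # 2 * x * y * (# 1 + # 7 * y
    - x * (y - # 1) * (# 7 * y ^ 2 + y - # 9)
    + x ^ 2 * (y - # 1) ^ 2 * (# 8 * y ^ 2 - # 17 * y + # 8))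
    / (# 1 - # 2 * x * (y ^ 2 + # 2 * y + # 5)
    + x ^ 2 * (y - # 1) * (y ^ 3 + # 6 * y ^ 2 + # 8 * y - # 17)
    - x ^ 3 * (y - # 1) ^ 2 * (y ^ 3 + # 6 * y ^ 2 - # 17 * y + # 8)))
theorem6p6 = listing 2 4 , λ L → record
  { leading  = at (agree-sound (denominator 0) 1ₚ _)
  ; quotient = λ n → at (quotient L n)
  }
  where
  quotient : ∀ L n → (genFun {4} {2} L * denominator) n ≐ numerator n
  -- Below 4 both sides are compared by evaluation. From 4 on both vanish: the left by the
  -- recurrence at `n ∸ 4`, the right because the numerator has degree at most 3 in `x`.
  quotient L n with n ℕ.<? 4
  ... | yes n<4 = ≐-trans (*-congˡ denominator (genFun≐rowSeries L) n) (initial-terms (∈-upTo⁺ n<4))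
  ... | no n≮4  = ≐-trans
    (subst (λ t → (genFun L * denominator) t ≐ 0ₚ) (ℕ.m∸n+n≡m (ℕ.≮⇒≥ n≮4))
      (genFun-recurrence L degree-denominator denominator-annihilates (n ∸ 4)))
    (≐-sym (degree-numerator n (ℕ.≮⇒≥ n≮4)))
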